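{- Let $\mathbf v\in\mathbb Z^4$ satisfy $Q_{\mathcal D}(\mathbf v)=4$, and let $\mathcal C$ be the set of all integers occurring as a coordinate of some element of the orbit $\mathcal A[\mathbf v]$ (the curvatures of the corresponding integral hyperbolic Apollonian packing). Then the set of residues modulo $12$ of elements of $\mathcal C$ omits at least three congruence classes modulo $12$.
   Context: $Q_{\mathcal D}(a,b,c,d)=2(a^2+b^2+c^2+d^2)-(a+b+c+d)^2$. $\mathbf S_i$ ($i=1,\dots,4$) is the $4\times4$ integer matrix replacing the $i$-th coordinate $a_i$ of a column vector by $2\sum_{j\ne i}a_j-a_i$, other coordinates fixed; the Apollonian group $\mathcal A$ is the subgroup of $GL(4,\mathbb Z)$ they generate, and $\mathcal A[\mathbf v]=\{\mathbf U\mathbf v:\mathbf U\in\mathcal A\}$. -}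

module Defs where

open import Data.Bool.Base using (if_then_else_)
open import Data.Fin.Base using (Fin; toℕ)
open import Data.Fin.Patterns using (0F; 1F; 2F; 3F)
open import Data.Fin.Properties using (_≟_; all?)
open import Data.Integer.Base using (ℤ; +_; _+_; _-_; _*_; _%ℕ_; 0ℤ; 1ℤ; -1ℤ)
open import Data.Integer.Properties as ℤ using (+-0-monoid)
open import Data.Integer.Tactic.RingSolver using (solve-∀)
open import Data.Nat.Base using (ℕ; NonZero)
open import Data.Product.Base using (∃-syntax; _×_)
open import Data.Vec.Functional using (Vector; removeAt)
open import Relation.Binary.PropositionalEquality using (_≡_; _≢_; refl; _≗_)
open import Relation.Nullary.Decidable using (does; from-yes)
open import Relation.Nullary.Negation using (contradiction)

open import Algebra.Properties.Monoid.Sum +-0-monoid public using (sum; sum-syntax)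

Q : Vector ℤ 4 → ℤ
Q v = + 2 * sum (λ i → v i * v i) - sum v * sum v

Matrix : ℕ → Set
Matrix n = Vector (Vector ℤ n) n

infix 4 _≋_
_≋_ : ∀ {n} → Matrix n → Matrix n → Set
M ≋ N = ∀ i j → M i j ≡ N i j

1ᴹ : ∀ {n} → Matrix n
1ᴹ i j = if does (i ≟ j) then 1ℤ else 0ℤ

infixl 7 _*ᴹ_
_*ᴹ_ : ∀ {n} → Matrix n → Matrix n → Matrix n
_*ᴹ_ {n} M N i k = ∑[ j < n ] (M i j * N j k)

infixr 7 _*ᵛ_
_*ᵛ_ : ∀ {n} → Matrix n → Vector ℤ n → Vector ℤ n
_*ᵛ_ {n} M v i = ∑[ j < n ] (M i j * v j)

S : Fin 4 → Matrix 4
S i j k =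
  if does (j ≟ i)
  then (if does (k ≟ i) then -1ℤ else + 2)
  else 1ᴹ j k

S-replaces : ∀ i (v : Vector ℤ 4) → (S i *ᵛ v) i ≡ + 2 * sum (removeAt v i) - v i
S-replaces 0F v = lemma (v 0F) (v 1F) (v 2F) (v 3F)
  where
  lemma : ∀ a b c d → -1ℤ * a + (+ 2 * b + (+ 2 * c + (+ 2 * d + 0ℤ))) ≡
                      + 2 * (b + (c + (d + 0ℤ))) - a
  lemma = solve-∀
S-replaces 1F v = lemma (v 0F) (v 1F) (v 2F) (v 3F)
  where
  lemma : ∀ a b c d → + 2 * a + (-1ℤ * b + (+ 2 * c + (+ 2 * d + 0ℤ))) ≡
                      + 2 * (a + (c + (d + 0ℤ))) - b
  lemma = solve-∀
S-replaces 2F v = lemma (v 0F) (v 1F) (v 2F) (v 3F)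
  where
  lemma : ∀ a b c d → + 2 * a + (+ 2 * b + (-1ℤ * c + (+ 2 * d + 0ℤ))) ≡
                      + 2 * (a + (b + (d + 0ℤ))) - c
  lemma = solve-∀
S-replaces 3F v = lemma (v 0F) (v 1F) (v 2F) (v 3F)
  where
  lemma : ∀ a b c d → + 2 * a + (+ 2 * b + (+ 2 * c + (-1ℤ * d + 0ℤ))) ≡
                      + 2 * (a + (b + (c + 0ℤ))) - d
  lemma = solve-∀

1ᴹ-identity : ∀ (v : Vector ℤ 4) → 1ᴹ *ᵛ v ≗ v
1ᴹ-identity v 0F = lemma (v 0F) (v 1F) (v 2F) (v 3F)
  where
  lemma : ∀ a b c d → 1ℤ * a + (0ℤ * b + (0ℤ * c + (0ℤ * d + 0ℤ))) ≡ a
  lemma = solve-∀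
1ᴹ-identity v 1F = lemma (v 0F) (v 1F) (v 2F) (v 3F)
  where
  lemma : ∀ a b c d → 0ℤ * a + (1ℤ * b + (0ℤ * c + (0ℤ * d + 0ℤ))) ≡ b
  lemma = solve-∀
1ᴹ-identity v 2F = lemma (v 0F) (v 1F) (v 2F) (v 3F)
  where
  lemma : ∀ a b c d → 0ℤ * a + (0ℤ * b + (1ℤ * c + (0ℤ * d + 0ℤ))) ≡ c
  lemma = solve-∀
1ᴹ-identity v 3F = lemma (v 0F) (v 1F) (v 2F) (v 3F)
  where
  lemma : ∀ a b c d → 0ℤ * a + (0ℤ * b + (0ℤ * c + (1ℤ * d + 0ℤ))) ≡ d
  lemma = solve-∀

S-fixes : ∀ i j (v : Vector ℤ 4) → j ≢ i → (S i *ᵛ v) j ≡ v j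
S-fixes 0F 0F v j≢i = contradiction refl j≢i
S-fixes 0F 1F v _ = 1ᴹ-identity v 1F
S-fixes 0F 2F v _ = 1ᴹ-identity v 2F
S-fixes 0F 3F v _ = 1ᴹ-identity v 3F
S-fixes 1F 0F v _ = 1ᴹ-identity v 0F
S-fixes 1F 1F v j≢i = contradiction refl j≢i
S-fixes 1F 2F v _ = 1ᴹ-identity v 2F
S-fixes 1F 3F v _ = 1ᴹ-identity v 3F
S-fixes 2F 0F v _ = 1ᴹ-identity v 0F
S-fixes 2F 1F v _ = 1ᴹ-identity v 1F
S-fixes 2F 2F v j≢i = contradiction refl j≢i
S-fixes 2F 3F v _ = 1ᴹ-identity v 3F
S-fixes 3F 0F v _ = 1ᴹ-identity v 0F
S-fixes 3F 1F v _ = 1ᴹ-identity v 1F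
S-fixes 3F 2F v _ = 1ᴹ-identity v 2F
S-fixes 3F 3F v j≢i = contradiction refl j≢i

-- Each generator lies in GL(4,ℤ), being its own inverse.
S-involutive : ∀ i → S i *ᴹ S i ≋ 1ᴹ
S-involutive = from-yes (all? λ i → all? λ j → all? λ k → (S i *ᴹ S i) j k ℤ.≟ 1ᴹ j k)

-- The subgroup of GL(4,ℤ) generated by the S i, as a predicate on integer
-- matrices. Matrices are functions, hence the explicit closure under _≋_.
data Apollonian : Matrix 4 → Set where
  generator : ∀ i → Apollonian (S i)
  identity  : Apollonian 1ᴹ
  product   : ∀ {U V} → Apollonian U → Apollonian V → Apollonian (U *ᴹ V)
  inverse   : ∀ {U V} → Apollonian U → U *ᴹ V ≋ 1ᴹ → V *ᴹ U ≋ 1ᴹ → Apollonian V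
  respects  : ∀ {U V} → U ≋ V → Apollonian U → Apollonian V

Orbit : Vector ℤ 4 → Vector ℤ 4 → Set
Orbit v w = ∃[ U ] (Apollonian U × U *ᵛ v ≗ w)

Curvature : Vector ℤ 4 → ℤ → Set
Curvature v c = ∃[ w ] (Orbit v w × ∃[ i ] w i ≡ c)

-- _%ℕ_ is the Euclidean remainder, non-negative for negative integers as well.
Residues : (m : ℕ) .{{_ : NonZero m}} → (ℤ → Set) → Fin m → Set
Residues m C r = ∃[ c ] (C c × c %ℕ m ≡ toℕ r)

{-# OPTIONS --safe #-}

-- The form Q is well defined modulo 8 on vectors modulo 4, so Q v = 4 leaves
-- finitely many residue vectors modulo 4.  All of them have an even coordinate
-- sum σ, and none contains all four residues.  Since S i replaces the
-- coordinate aᵢ by 2(σ - aᵢ) - aᵢ ≡ aᵢ + 2σ ≡ aᵢ modulo 4, the orbit is constant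
-- modulo 4, and a residue modulo 4 missing from v accounts for three missing
-- residues modulo 12.
module Submission where

open import Defs
open import Data.Fin.Base using (Fin; toℕ; fromℕ<)
open import Data.Fin.Patterns using (0F; 1F; 2F; 3F)
open import Data.Fin.Properties using (_≟_; all?; any?; toℕ-fromℕ<)
open import Data.Fin.Subset using (Subset; _∈_; ∣_∣)
open import Data.Fin.Subset.Properties using (_∈?_)
open import Data.Integer.Base using (ℤ; +_; _+_; _-_; -_; _*_; _%ℕ_; _/ℕ_; 0ℤ)
open import Data.Integer.Divisibility.Signed as Div using (divides)
open import Data.Integer.DivMod using (a≡a%ℕn+[a/ℕn]*n; n%ℕd<d)
open import Data.Integer.Properties using (+-*-semiring; *-assoc; pos-*)
open import Data.Integer.Tactic.RingSolver using (solve-∀)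
open import Data.Nat.Base as ℕ using (ℕ; NonZero; _≤_)
open import Data.Nat.Properties using (_≤?_)
open import Data.Product.Base using (Σ; ∃; _×_; _,_)
open import Data.Vec.Base using (tabulate)
open import Data.Vec.Functional using (Vector; removeAt; []; _∷_)
open import Function.Base using (_∘_)
open import Relation.Binary.PropositionalEquality using (_≡_; _≗_; refl; sym; trans; cong; cong₂; module ≡-Reasoning)
open import Relation.Nullary.Decidable using (Dec; does; yes; no; from-yes; map′; ¬?; _×-dec_; _→-dec_)
open import Relation.Nullary.Negation using (¬_)

open import Algebra.Properties.Semiring.Sum +-*-semiring using (*-distribˡ-sum; *-distribʳ-sum; ∑-comm; sum-remove; sum-cong-≗)

-- Congruences of integers and of integer vectors

infix 4 _≡_[mod_] _≗_[mod_] _≡?_[mod_]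

-- With the quotient as an explicit field, each law of congruences becomes a polynomial identity
-- that the ring solver settles.
record _≡_[mod_] (a b : ℤ) (m : ℕ) : Set where
  constructor congruent
  field
    quotient : ℤ
    equality : a ≡ b + quotient * + m

open _≡_[mod_]

_≗_[mod_] : ∀ {n} → Vector ℤ n → Vector ℤ n → ℕ → Set
w ≗ u [mod m ] = ∀ i → w i ≡ u i [mod m ]

module _ {m : ℕ} where

  mod-reflexive : ∀ {a b} → a ≡ b → a ≡ b [mod m ]
  mod-reflexive {a} refl = congruent 0ℤ (lemma a (+ m))
    where
    lemma : ∀ a m → a ≡ a + 0ℤ * m
    lemma = solve-∀

  mod-sym : ∀ {a b} → a ≡ b [mod m ] → b ≡ a [mod m ]
  mod-sym {b = b} (congruent q refl) = congruent (- q) (lemma b q (+ m))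
    where
    lemma : ∀ b q m → b ≡ (b + q * m) + - q * m
    lemma = solve-∀

  mod-trans : ∀ {a b c} → a ≡ b [mod m ] → b ≡ c [mod m ] → a ≡ c [mod m ]
  mod-trans {c = c} (congruent p refl) (congruent q refl) =
    congruent (p + q) (lemma c p q (+ m))
    where
    lemma : ∀ c p q m → (c + q * m) + p * m ≡ c + (p + q) * m
    lemma = solve-∀

  sum-cong-mod : ∀ {n} {w u : Vector ℤ n} → w ≗ u [mod m ] → sum w ≡ sum u [mod m ]
  sum-cong-mod {ℕ.zero}          w≗u = mod-reflexive refl
  sum-cong-mod {ℕ.suc n} {w} {u} w≗u with w≗u 0F | sum-cong-mod (w≗u ∘ Fin.suc)
  ... | congruent p w₀≡ | congruent q ws≡ = congruent (p + q)
    (trans (cong₂ _+_ w₀≡ ws≡) (lemma (u 0F) (sum (u ∘ Fin.suc)) p q (+ m)))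
    where
    lemma : ∀ a b p q m → (a + p * m) + (b + q * m) ≡ (a + b) + (p + q) * m
    lemma = solve-∀

_≡?_[mod_] : ∀ a b m → Dec (a ≡ b [mod m ])
a ≡? b [mod m ] = map′
  (λ (divides q a-b≡) → congruent q (trans (lemma₁ a b) (cong (_+_ b) a-b≡)))
  (λ (congruent q a≡) → divides q (trans (cong (_- b) a≡) (lemma₂ b (q * + m))))
  (+ m Div.∣? a - b)
  where
  lemma₁ : ∀ a b → a ≡ b + (a - b)
  lemma₁ = solve-∀
  lemma₂ : ∀ b x → (b + x) - b ≡ x
  lemma₂ = solve-∀

-- The modulus is written as a product so that 4 and 12 match `2 ℕ.* 2` and `3 ℕ.* 4` by evaluation.
mod-∣ : ∀ m k {a b} → a ≡ b [mod m ℕ.* k ] → a ≡ b [mod k ]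
mod-∣ m k {b = b} (congruent q refl) = congruent (q * + m)
  (cong (_+_ b) (trans (cong (q *_) (pos-* m k)) (sym (*-assoc q (+ m) (+ k)))))

%ℕ-mod : ∀ a m .{{_ : NonZero m}} → a ≡ + (a %ℕ m) [mod m ]
%ℕ-mod a m = congruent (a /ℕ m) (a≡a%ℕn+[a/ℕn]*n a m)

-- The action of matrices on vectors

*ᵛ-congˡ : ∀ {n} {U V : Matrix n} w → U ≋ V → U *ᵛ w ≗ V *ᵛ w
*ᵛ-congˡ w U≋V i = sum-cong-≗ λ j → cong (_* w j) (U≋V i j)

*ᴹ-*ᵛ-assoc : ∀ {n} (U V : Matrix n) w → (U *ᴹ V) *ᵛ w ≗ U *ᵛ V *ᵛ w
*ᴹ-*ᵛ-assoc {n} U V w i = begin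
  ∑[ k < n ] ((∑[ j < n ] (U i j * V j k)) * w k)
    ≡⟨ sum-cong-≗ (λ k → *-distribʳ-sum (w k) (λ j → U i j * V j k)) ⟩
  ∑[ k < n ] ∑[ j < n ] (U i j * V j k * w k)
    ≡⟨ ∑-comm (λ k j → U i j * V j k * w k) ⟩
  ∑[ j < n ] ∑[ k < n ] (U i j * V j k * w k)
    ≡⟨ sum-cong-≗ (λ j → sum-cong-≗ λ k → *-assoc (U i j) (V j k) (w k)) ⟩
  ∑[ j < n ] ∑[ k < n ] (U i j * (V j k * w k))
    ≡⟨ sum-cong-≗ (λ j → *-distribˡ-sum (U i j) (λ k → V j k * w k)) ⟨
  ∑[ j < n ] (U i j * ∑[ k < n ] (V j k * w k)) ∎
  where open ≡-Reasoning

*ᵛ-inverse : ∀ (U V : Matrix 4) w → U *ᴹ V ≋ 1ᴹ → U *ᵛ V *ᵛ w ≗ w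
*ᵛ-inverse U V w UV≋1 i = trans (sym (*ᴹ-*ᵛ-assoc U V w i))
  (trans (*ᵛ-congˡ w UV≋1 i) (1ᴹ-identity w i))

-- Invariance of the orbit modulo 4

S-fixes-mod4 : ∀ i w → sum w ≡ 0ℤ [mod 2 ] → S i *ᵛ w ≗ w [mod 4 ]
S-fixes-mod4 i w (congruent q sum≡) j = by-cases (j ≟ i)
  where
  open ≡-Reasoning
  rest = sum (removeAt w i)
  lemma₁ : ∀ a r → + 2 * r - a ≡ + 2 * (a + r) - + 3 * a
  lemma₁ = solve-∀
  lemma₂ : ∀ a q → + 2 * (0ℤ + q * + 2) - + 3 * a ≡ a + (q - a) * + 4
  lemma₂ = solve-∀
  by-cases : Dec (j ≡ i) → (S i *ᵛ w) j ≡ w j [mod 4 ]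
  by-cases (no j≢i)   = mod-reflexive (S-fixes i j w j≢i)
  -- As `sum w` is `2q`, the new coordinate is `2 * sum w - 3 * w i = 4q - 3 * w i`, which exceeds
  -- `w i` by `4 (q - w i)`.
  by-cases (yes refl) = congruent (q - w i) (begin
    (S i *ᵛ w) i                      ≡⟨ S-replaces i w ⟩
    + 2 * rest - w i                  ≡⟨ lemma₁ (w i) rest ⟩
    + 2 * (w i + rest) - + 3 * w i    ≡⟨ cong (λ s → + 2 * s - + 3 * w i) (trans (sym (sum-remove w)) sum≡) ⟩
    + 2 * (0ℤ + q * + 2) - + 3 * w i  ≡⟨ lemma₂ (w i) q ⟩
    w i + (q - w i) * + 4             ∎)

module _ {u : Vector ℤ 4} (even : sum u ≡ 0ℤ [mod 2 ]) where

  S-preserves : ∀ i {w} → w ≗ u [mod 4 ] → S i *ᵛ w ≗ u [mod 4 ]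
  S-preserves i {w} w≗u j = mod-trans (S-fixes-mod4 i w even-w j) (w≗u j)
    where
    even-w : sum w ≡ 0ℤ [mod 2 ]
    -- The parity of the sum depends only on the vector modulo 4, so evenness for `u` serves every
    -- vector met along the orbit.
    even-w = mod-trans (mod-∣ 2 2 (sum-cong-mod w≗u)) even

  -- Stating both directions makes the property pass to inverses.
  preserves : ∀ {U} → Apollonian U → ∀ {w} → w ≗ u [mod 4 ] → U *ᵛ w ≗ u [mod 4 ]
  reflects  : ∀ {U} → Apollonian U → ∀ {w} → U *ᵛ w ≗ u [mod 4 ] → w ≗ u [mod 4 ]

  preserves (generator i) w≗u = S-preserves i w≗u
  preserves identity {w} w≗u j = mod-trans (mod-reflexive (1ᴹ-identity w j)) (w≗u j)
  preserves (product {U} {V} A B) {w} w≗u j =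
    mod-trans (mod-reflexive (*ᴹ-*ᵛ-assoc U V w j)) (preserves A (preserves B w≗u) j)
  preserves (inverse {U} {V} A UV≋1 _) {w} w≗u =
    reflects A λ j → mod-trans (mod-reflexive (*ᵛ-inverse U V w UV≋1 j)) (w≗u j)
  preserves (respects U≋V A) {w} w≗u j =
    mod-trans (mod-reflexive (sym (*ᵛ-congˡ w U≋V j))) (preserves A w≗u j)

  -- Since `S i` is an involution, `w` is `S i` applied to `S i *ᵛ w`, and preservation applies to
  -- the latter.
  reflects (generator i) {w} Sw≗u j =
    mod-trans (mod-reflexive (sym (*ᵛ-inverse (S i) (S i) w (S-involutive i) j)))
      (S-preserves i Sw≗u j)
  reflects identity {w} w≗u j = mod-trans (mod-reflexive (sym (1ᴹ-identity w j))) (w≗u j)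
  reflects (product {U} {V} A B) {w} UVw≗u = reflects B (reflects A λ j →
    mod-trans (mod-reflexive (sym (*ᴹ-*ᵛ-assoc U V w j))) (UVw≗u j))
  reflects (inverse {U} {V} A UV≋1 _) {w} Vw≗u j =
    mod-trans (mod-reflexive (sym (*ᵛ-inverse U V w UV≋1 j))) (preserves A Vw≗u j)
  reflects (respects U≋V A) {w} Vw≗u =
    reflects A λ j → mod-trans (mod-reflexive (*ᵛ-congˡ w U≋V j)) (Vw≗u j)

  curvature-mod4 : ∀ {v c} → v ≗ u [mod 4 ] → Curvature v c → ∃ λ i → c ≡ u i [mod 4 ]
  curvature-mod4 v≗u (w , (U , A , Uv≗w) , i , wi≡c) =
    i , mod-trans (mod-reflexive (sym (trans (Uv≗w i) wi≡c))) (preserves A v≗u i)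

-- The form modulo 8

Q-mod8 : ∀ {w u} → w ≗ u [mod 4 ] → Q w ≡ Q u [mod 8 ]
-- Write `w = u + 4q`. Twice the sum of squares grows by `16 u·q + 32 q·q`, and the squared sum
-- grows by `8 (sum u)(sum q) + 16 (sum q)²`. The witness is the difference of these, divided by 8.
Q-mod8 {w} {u} w≗u = congruent (+ 2 * sum (λ i → u i * q i) + + 4 * sum (λ i → q i * q i) - sum u * sum q - + 2 * (sum q * sum q))
  (trans (cong₂ (λ x y → + 2 * x - y * y)
           (sum-cong-≗ λ i → cong₂ _*_ (equality (w≗u i)) (equality (w≗u i)))
           (sum-cong-≗ λ i → equality (w≗u i)))
    (lemma (u 0F) (u 1F) (u 2F) (u 3F) (q 0F) (q 1F) (q 2F) (q 3F)))
  where
  q : Vector ℤ 4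
  q i = quotient (w≗u i)
  lemma : ∀ a b c d p q r s →
    let a′ = a + p * + 4; b′ = b + q * + 4; c′ = c + r * + 4; d′ = d + s * + 4
        σ′ = a′ + (b′ + (c′ + (d′ + 0ℤ)))
        σ = a + (b + (c + (d + 0ℤ)))
        τ = p + (q + (r + (s + 0ℤ)))
    in + 2 * (a′ * a′ + (b′ * b′ + (c′ * c′ + (d′ * d′ + 0ℤ)))) - σ′ * σ′
       ≡ (+ 2 * (a * a + (b * b + (c * c + (d * d + 0ℤ)))) - σ * σ)
         + (+ 2 * (a * p + (b * q + (c * r + (d * s + 0ℤ))))
            + + 4 * (p * p + (q * q + (r * r + (s * s + 0ℤ))))
            - σ * τ - + 2 * (τ * τ)) * + 8
  lemma = solve-∀

-- Finite check over residue vectors modulo 4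

⟦_⟧ : ∀ {m} → Fin m → ℤ
⟦ r ⟧ = + toℕ r

vector : (a b c d : Fin 4) → Vector ℤ 4
vector a b c d = ⟦ a ⟧ ∷ ⟦ b ⟧ ∷ ⟦ c ⟧ ∷ ⟦ d ⟧ ∷ []

Misses : Vector ℤ 4 → Fin 4 → Set
Misses u ρ = ∀ i → ¬ ⟦ ρ ⟧ ≡ u i [mod 4 ]

-- The premise is a congruence modulo 8 because that is what remains of `Q v ≡ + 4` once `v` is
-- replaced by its residues modulo 4.
Admissible : Vector ℤ 4 → Set
Admissible u = Q u ≡ + 4 [mod 8 ] → sum u ≡ 0ℤ [mod 2 ] × ∃ (Misses u)

admissible? : ∀ u → Dec (Admissible u)
admissible? u = (Q u ≡? + 4 [mod 8 ]) →-dec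
  ((sum u ≡? 0ℤ [mod 2 ]) ×-dec any? λ ρ → all? λ i → ¬? (⟦ ρ ⟧ ≡? u i [mod 4 ]))

all-admissible? : Dec (∀ (a b c d : Fin 4) → Admissible (vector a b c d))
all-admissible? = all? λ a → all? λ b → all? λ c → all? λ d → admissible? (vector a b c d)

-- Decided by evaluation on the 256 vectors. By hand: `Q u` has the parity of `sum u`, so the sum is
-- even; a vector with all four residues is a permutation of (0,1,2,3), where the form is 28 - 36 =
-- -8, not 4 modulo 8.
all-admissible : ∀ a b c d → Admissible (vector a b c d)
all-admissible = from-yes all-admissible?

-- Omitted classes modulo 12

class : Fin 4 → Subset 12
class ρ = tabulate λ r → does (⟦ r ⟧ ≡? ⟦ ρ ⟧ [mod 4 ])

-- The members are `ρ`, `ρ + 4` and `ρ + 8`.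
class-size : ∀ ρ → 3 ≤ ∣ class ρ ∣
class-size = from-yes (all? λ ρ → 3 ≤? ∣ class ρ ∣)

class-sound : ∀ ρ r → r ∈ class ρ → ⟦ r ⟧ ≡ ⟦ ρ ⟧ [mod 4 ]
class-sound = from-yes (all? λ ρ → all? λ r → (r ∈? class ρ) →-dec (⟦ r ⟧ ≡? ⟦ ρ ⟧ [mod 4 ]))

residue : ℤ → Fin 4
residue a = fromℕ< (n%ℕd<d a 4)

residue-mod : ∀ a → a ≡ ⟦ residue a ⟧ [mod 4 ]
residue-mod a = mod-trans (%ℕ-mod a 4)
  (mod-reflexive (cong +_ (sym (toℕ-fromℕ< (n%ℕd<d a 4)))))

-- As 4 divides 12, a curvature with residue `r` would be `ρ` modulo 4, yet every curvature agrees
-- modulo 4 with some coordinate of `u`, and none of these is `ρ`.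
class-omitted : ∀ {u v} ρ → v ≗ u [mod 4 ] → sum u ≡ 0ℤ [mod 2 ] → Misses u ρ →
  ∀ r → r ∈ class ρ → ¬ Residues 12 (Curvature v) r
class-omitted ρ v≗u even missed r r∈ (c , C , c%12≡r) =
  let i , c≡uᵢ = curvature-mod4 even v≗u C in missed i (mod-trans (mod-sym c≡ρ) c≡uᵢ)
  where
  c≡ρ : c ≡ ⟦ ρ ⟧ [mod 4 ]
  c≡ρ = mod-trans (mod-∣ 3 4 (%ℕ-mod c 12))
    (mod-trans (mod-reflexive (cong +_ c%12≡r)) (class-sound ρ r r∈))

theorem5p2 : (v : Vector ℤ 4) → Q v ≡ + 4 →
    Σ (Subset 12) λ omitted → (3 ≤ ∣ omitted ∣ × (∀ r → r ∈ omitted → ¬ Residues 12 (Curvature v) r))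
theorem5p2 v Qv≡4 =
  let even , ρ , missed = all-admissible (residue (v 0F)) (residue (v 1F)) (residue (v 2F)) (residue (v 3F))
        (mod-trans (mod-sym (Q-mod8 v≗u)) (mod-reflexive Qv≡4))
  in class ρ , class-size ρ , class-omitted ρ v≗u even missed
  where
  u : Vector ℤ 4
  u = vector (residue (v 0F)) (residue (v 1F)) (residue (v 2F)) (residue (v 3F))

  v≗u : v ≗ u [mod 4 ]
  v≗u 0F = residue-mod (v 0F)
  v≗u 1F = residue-mod (v 1F)
  v≗u 2F = residue-mod (v 2F)
  v≗u 3F = residue-mod (v 3F)
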